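{- Let $k\ge 1$ be an integer. Every regular $\underline{\mathcal{F}_k}$-independent code $X\subseteq A^*$ can be embedded into some complete one; that is, there exists a complete regular $\underline{\mathcal{F}_k}$-independent code $Z\subseteq A^*$ with $X\subseteq Z$.
   Context: $A$ is a finite alphabet with $|A|\ge 2$; $A^*$ is the free monoid over $A$ and $|w|$ is the length of $w$. A subset of $A^*$ is regular if it is recognized by a finite automaton. A set $X\subseteq A^*$ is a code if for all words $x_1,\dots,x_n,y_1,\dots,y_p\in X$, $x_1\cdots x_n=y_1\cdots y_p$ implies $n=p$ and $x_i=y_i$ for every $i$. $X$ is complete if every word of $A^*$ is a factor (contiguous subword) of some word in $X^*$, the submonoid generated by $X$. $(w,w')\in\mathcal{F}_k$ iff $|w|+|w'|-2|f|\le k$, where $f$ is a maximum length common factor of $w$ and $w'$; $\underline{\mathcal{F}_k}=\mathcal{F}_k\setminus\{(w,w):w\in A^*\}$. For a relation $\tau\subseteq A^*\times A^*$, $\tau(X)=\{y:\exists x\in X,\ (x,y)\in\tau\}$, and $X$ is $\tau$-independent if $\tau(X)\cap X=\emptyset$. -}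

module Defs where

open import Data.Fin.Base using (Fin)
open import Data.Fin.Subset using (Subset) renaming (_∈_ to _∈ˢ_)
open import Data.List.Base using (List; length; concat; foldl)
open import Data.List.Relation.Binary.Infix.Heterogeneous using (Infix)
open import Data.List.Relation.Unary.All using (All)
open import Data.Nat.Base using (ℕ; _+_; _*_; _∸_; _≤_)
open import Data.Product.Base using (∃-syntax; _×_)
open import Function.Bundles using (_⇔_)
open import Level using (0ℓ)
open import Relation.Binary.Core using (Rel)
open import Relation.Binary.PropositionalEquality.Core using (_≡_; _≢_)
open import Relation.Unary using (Pred; _∈_; _∩_; Empty)

Language : Set → Set₁
Language A = Pred (List A) 0ℓ

-- Complete deterministic finite automata.
record Automaton (A : Set) : Set where
  field
    states  : ℕ
    initial : Fin states
    final   : Subset states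
    step    : Fin states → A → Fin states

module _ {A : Set} where

  Accepts : Automaton A → Language A
  Accepts M w = foldl step initial w ∈ˢ final
    where open Automaton M

  Regular : Language A → Set
  Regular X = ∃[ M ] (∀ w → w ∈ X ⇔ w ∈ Accepts M)

  Factor : Rel (List A) 0ℓ
  Factor = Infix _≡_

  Star : Language A → Language A
  Star X w = ∃[ ws ] All X ws × concat ws ≡ w

  -- Equality of the lists xs and ys says at once that n = p and that
  -- xᵢ = yᵢ for every i.  Admitting the empty factorization is harmless:
  -- either way, a code cannot contain the empty word.
  Code : Language A → Set
  Code X = ∀ xs ys → All X xs → All X ys → concat xs ≡ concat ys → xs ≡ ys

  Complete : Language A → Set
  Complete X = ∀ w → ∃[ v ] v ∈ Star X × Factor w v

  MaxCommonFactor : List A → List A → Language A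
  MaxCommonFactor w w′ f =
    Factor f w × Factor f w′ ×
    (∀ g → Factor g w → Factor g w′ → length g ≤ length f)

  -- The subtraction never truncates, since f is a factor of both words.
  𝓕 : ℕ → Rel (List A) 0ℓ
  𝓕 k w w′ =
    ∃[ f ] MaxCommonFactor w w′ f × length w + length w′ ∸ 2 * length f ≤ k

  -- τ with the diagonal removed.
  antireflexive : Rel (List A) 0ℓ → Rel (List A) 0ℓ
  antireflexive τ w w′ = τ w w′ × w ≢ w′

  image : Rel (List A) 0ℓ → Language A → Language A
  image τ X y = ∃[ x ] x ∈ X × τ x y

  Independent : Rel (List A) 0ℓ → Language A → Set
  Independent τ X = Empty (image τ X ∩ X)

{-# OPTIONS --safe #-}
module Submission where

-- If X is not complete, some word w is not a factor of X*.  Put M = k + |w| + 2 and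
-- y = aᴹ b w a bᴹ.  This word is unbordered, so that Z = X ∪ y(Uy)*, where U is the
-- set of words outside X* without factor y, is a complete code by the classical
-- argument of Ehrenfeucht and Rozenberg.  If two words of y(Uy)* are at factor
-- distance at most k, their common factor starts within the runs aᴹ and ends within
-- the runs bᴹ; the letters next to these runs determine where, and the two words
-- coincide.  A word of X at distance at most k from a word of y(Uy)* would contain w.
-- Whether X is complete is decidable, since the set of factors of X* is regular.

open import Defs
open import Data.Bool.Base using (if_then_else_; true)
open import Data.Empty using (⊥)
open import Data.Fin.Base using (Fin; zero; suc; toℕ; combine; remQuot; funToFin; finToFun)
open import Data.Fin.Properties as Fin using (any?; finToFun-funToFin; remQuot-combine; +↔⊎; pigeonhole)
open import Data.Fin.Subset using (Subset) renaming (_∈_ to _∈ˢ_)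
open import Data.Fin.Subset.Properties using () renaming (_∈?_ to _∈ˢ?_)
open import Data.List.Base
  using (List; []; _∷_; _++_; _∷ʳ_; [_]; length; concat; foldl; drop; take; replicate; reverse)
open import Data.List.Properties
  using (≡-dec; ∷-injective; ∷-injectiveˡ; ∷-injectiveʳ; ++-assoc; ++-identityʳ; ++-cancelˡ; ++-cancelʳ;
         ++-conicalˡ; foldl-++; concat-++; take++drop≡id; length-take; length-drop; length-++; length-++-≤ˡ;
         length-replicate; length-reverse; reverse-++; reverse-injective; unfold-reverse)
open import Data.List.Relation.Binary.Infix.Heterogeneous as Infix using (MkView; here; there; _++ⁱ_; _ⁱ++_)
open import Data.List.Relation.Binary.Pointwise using (Pointwise-≡⇒≡; ≡⇒Pointwise-≡)
open import Data.List.Relation.Binary.Prefix.Heterogeneous as Prefix using (Prefix; _++ᵖ_)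
open import Data.List.Relation.Binary.Prefix.Heterogeneous.Properties using (prefix?)
open import Data.List.Relation.Unary.All as All using (All; []; _∷_)
open import Data.List.Relation.Unary.All.Properties using (++⁺)
open import Data.Nat.Base using (ℕ; zero; suc; _+_; _*_; _∸_; _^_; _≤_; _<_; z≤n; s≤s; s≤s⁻¹; z<s)
open import Data.Nat.Induction using (<-wellFounded)
open import Data.Nat.Properties as ℕ using ()
open import Data.Nat.Tactic.RingSolver using (solve-∀)
open import Data.Product.Base using (∃-syntax; Σ-syntax; ∃; _×_; _,_; proj₁; proj₂)
open import Data.Sum.Base using (_⊎_; inj₁; inj₂)
open import Data.Sum.Properties using () renaming (≡-dec to ⊎-≡-dec)
open import Data.Unit.Base using (tt)
open import Data.Vec.Base using (tabulate)
open import Data.Vec.Properties using (lookup∘tabulate; []=⇒lookup; lookup⇒[]=)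
open import Function.Base using (_∘_)
open import Function.Bundles using (_⇔_; _↔_; mk⇔; Inverse; Equivalence)
open import Function.Properties.Inverse using (↔-refl; ↔-sym; ↔⇒↣)
open import Induction.WellFounded using (Acc; acc)
open import Level using (0ℓ)
open import Relation.Binary.Definitions using (DecidableEquality; tri<; tri≈; tri>)
open import Relation.Binary.PropositionalEquality
  using (_≡_; _≢_; refl; sym; trans; cong; cong₂; subst; subst₂; module ≡-Reasoning)
open import Relation.Nullary using (Dec; yes; no; ¬_; does; contradiction; _×-dec_; _⊎-dec_; ¬?)
open import Relation.Nullary.Decidable as Dec using (map′; decidable-stable)
open import Relation.Unary using (Pred; _∈_; _∉_; _∪_; ∁; _⊆_; Decidable; ｛_｝; U)

open Equivalence using (to; from)

private
  variable
    A Q : Set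
    a b x : A
    m n : ℕ
    X Y : Language A

-- Closure and decision properties of regular languages

any-finite? : Q ↔ Fin n → {P : Pred Q 0ℓ} → Decidable P → Dec (∃ P)
any-finite? Q↔Fin {P} P? =
  map′ (λ (i , p) → F.from i , p)
       (λ (q , p) → F.to q , subst P (sym (F.strictlyInverseʳ q)) p)
       (any? (P? ∘ F.from))
  where module F = Inverse Q↔Fin

subset : {P : Pred (Fin n) 0ℓ} → Decidable P → Subset n
subset P? = tabulate (does ∘ P?)

∈-subset : {P : Pred (Fin n) 0ℓ} (P? : Decidable P) → ∀ i → i ∈ˢ subset P? ⇔ P i
∈-subset {P = P} P? i = mk⇔
  (λ i∈ → sound (trans (sym (lookup∘tabulate (does ∘ P?) i)) ([]=⇒lookup i∈)))
  (λ p → lookup⇒[]= i _ (trans (lookup∘tabulate (does ∘ P?) i) (Dec.dec-true (P? i) p)))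
  where
  sound : does (P? i) ≡ true → P i
  sound eq with P? i
  ... | yes p = p

-- A state of the powerset automaton is the number whose binary digits are the
-- characteristic function of a set of states.
module _ (Q↔Fin : Q ↔ Fin n) where

  private module F = Inverse Q↔Fin

  Member : Fin (2 ^ n) → Pred Q 0ℓ
  Member S q = finToFun S (F.to q) ≡ suc zero

  member? : ∀ S → Decidable (Member S)
  member? S q = finToFun S (F.to q) Fin.≟ suc zero

  encode : {P : Pred Q 0ℓ} → Decidable P → Fin (2 ^ n)
  encode P? = funToFin (λ i → if does (P? (F.from i)) then suc zero else zero)

  member-encode : {P : Pred Q 0ℓ} (P? : Decidable P) → ∀ q → Member (encode P?) q ⇔ P q
  member-encode {P} P? q
    rewrite finToFun-funToFin (λ i → if does (P? (F.from i)) then suc {1} zero else zero) (F.to q)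
          | F.strictlyInverseʳ q with P? q
  ... | yes p = mk⇔ (λ _ → p) (λ _ → refl)
  ... | no ¬p = mk⇔ (λ ()) (λ p → contradiction p ¬p)

-- The languages L q solve a right-linear system of
-- equations, that is, of a nondeterministic automaton with transitions δ.
module Powerset
  (Q↔Fin : Q ↔ Fin n) (L : Q → Language A) (ε? : Decidable (λ q → [] ∈ L q))
  {δ : Q → A → Pred Q 0ℓ} (δ? : ∀ q a → Decidable (δ q a))
  (L-∷ : ∀ q a w → a ∷ w ∈ L q ⇔ (∃[ r ] δ q a r × w ∈ L r))
  where

  private
    Final? : Decidable (λ S → ∃[ q ] Member Q↔Fin S q × [] ∈ L q)
    Final? S = any-finite? Q↔Fin (λ q → member? Q↔Fin S q ×-dec ε? q)

    Next? : ∀ S a → Decidable (λ r → ∃[ q ] Member Q↔Fin S q × δ q a r)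
    Next? S a r = any-finite? Q↔Fin (λ q → member? Q↔Fin S q ×-dec δ? q a r)

    run : ∀ S w → foldl (λ S a → encode Q↔Fin (Next? S a)) S w ∈ˢ subset Final? ⇔
                  (∃[ q ] Member Q↔Fin S q × w ∈ L q)
    run S [] = ∈-subset Final? S
    run S (a ∷ w) = mk⇔
      (λ run∈ → let r , r∈ , w∈ = to (run _ w) run∈
                    q , q∈ , q→r = to (member-encode Q↔Fin (Next? S a) r) r∈
                in q , q∈ , from (L-∷ q a w) (r , q→r , w∈))
      (λ (q , q∈ , aw∈) → let r , q→r , w∈ = to (L-∷ q a w) aw∈ in
        from (run _ w) (r , from (member-encode Q↔Fin (Next? S a) r) (q , q∈ , q→r) , w∈))

  -- A whole set of initial states is allowed because `regular-Factors` starts from every accessible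
  -- state.
  regular : {I : Pred Q 0ℓ} → Decidable I → Regular (λ w → ∃[ q ] I q × w ∈ L q)
  regular I? =
    record { initial = encode Q↔Fin I? ; final = subset Final? ; step = λ S a → encode Q↔Fin (Next? S a) } ,
    λ w → mk⇔
      (λ (q , i , w∈) → from (run _ w) (q , from (member-encode Q↔Fin I? q) i , w∈))
      (λ run∈ → let q , q∈ , w∈ = to (run _ w) run∈ in q , to (member-encode Q↔Fin I? q) q∈ , w∈)

regular-resp : (∀ w → w ∈ X ⇔ w ∈ Y) → Regular X → Regular Y
regular-resp X⇔Y (M , X⇔M) =
  M , λ w → mk⇔ (to (X⇔M w) ∘ from (X⇔Y w)) (to (X⇔Y w) ∘ from (X⇔M w))

regular? : Regular X → Decidable X
regular? (M , X⇔M) w =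
  map′ (from (X⇔M w)) (to (X⇔M w)) (foldl step initial w ∈ˢ? final)
  where open Automaton M

regular-∁ : Regular X → Regular (∁ X)
regular-∁ (M , X⇔M) =
  record M { final = subset ∉final? } ,
  λ w → mk⇔ (λ w∉X → from (∈-subset ∉final? _) (w∉X ∘ from (X⇔M w)))
            (λ w∈ → to (∈-subset ∉final? _) w∈ ∘ to (X⇔M w))
  where
  open Automaton M
  ∉final? = λ q → ¬? (q ∈ˢ? final)

regular-∪ : Regular X → Regular Y → Regular (X ∪ Y)
regular-∪ {X = X} {Y = Y} (M , X⇔M) (N , Y⇔N) =
  record { initial = combine M.initial N.initial ; final = subset Final? ; step = step } ,
  λ w → mk⇔ (accept w) (reject w)
  where
  module M = Automaton M
  module N = Automaton N

  left : Fin (M.states * N.states) → Fin M.states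
  left i = proj₁ (remQuot {M.states} N.states i)

  right : Fin (M.states * N.states) → Fin N.states
  right i = proj₂ (remQuot {M.states} N.states i)

  step = λ i a → combine (M.step (left i) a) (N.step (right i) a)

  Final? : Decidable (λ i → left i ∈ˢ M.final ⊎ right i ∈ˢ N.final)
  Final? i = (left i ∈ˢ? M.final) ⊎-dec (right i ∈ˢ? N.final)

  -- Induction on the word for the product automaton; each transition first decodes the pair, so
  -- `remQuot-combine` is applied once per letter.
  run : ∀ w p q → foldl step (combine p q) w ≡ combine (foldl M.step p w) (foldl N.step q w)
  run [] p q = refl
  run (a ∷ w) p q = trans
    (cong (λ (p , q) → foldl step (combine (M.step p a) (N.step q a)) w) (remQuot-combine p q))
    (run w (M.step p a) (N.step q a))

  final⇔ : ∀ w → foldl step (combine M.initial N.initial) w ∈ˢ subset Final? ⇔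
                 (w ∈ Accepts M ⊎ w ∈ Accepts N)
  final⇔ w rewrite run w M.initial N.initial = subst
    (λ (p , q) → combine p′ q′ ∈ˢ subset Final? ⇔ (p ∈ˢ M.final ⊎ q ∈ˢ N.final))
    (remQuot-combine p′ q′) (∈-subset Final? (combine p′ q′))
    where
    p′ = foldl M.step M.initial w
    q′ = foldl N.step N.initial w

  accept : ∀ w → w ∈ X ∪ Y → foldl step (combine M.initial N.initial) w ∈ˢ subset Final?
  accept w (inj₁ x) = from (final⇔ w) (inj₁ (to (X⇔M w) x))
  accept w (inj₂ y) = from (final⇔ w) (inj₂ (to (Y⇔N w) y))

  reject : ∀ w → foldl step (combine M.initial N.initial) w ∈ˢ subset Final? → w ∈ X ∪ Y
  reject w run∈ with to (final⇔ w) run∈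
  ... | inj₁ x = inj₁ (from (X⇔M w) x)
  ... | inj₂ y = inj₂ (from (Y⇔N w) y)

regular-U : Regular {A} U
regular-U =
  record { states = 1 ; initial = zero ; final = subset U? ; step = λ q _ → q } ,
  λ w → mk⇔ (λ _ → from (∈-subset U? _) tt) (λ _ → tt)
  where
  U? : Decidable {A = Fin 1} U
  U? _ = yes tt

-- State i is the suffix of w starting at position i.
regular-｛_｝ : DecidableEquality A → ∀ (w : List A) → Regular ｛ w ｝
regular-｛_｝ {A} _≟_ w = regular-resp singleton (Powerset.regular ↔-refl L ε? δ? L-∷ (Fin._≟ zero))
  where
  L : Fin (suc (length w)) → Language A
  L i = ｛ drop (toℕ i) w ｝

  ε? = λ i → ≡-dec _≟_ (drop (toℕ i) w) []
  δ? = λ i a j → ≡-dec _≟_ (drop (toℕ i) w) (a ∷ drop (toℕ j) w)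

  next : ∀ (w : List A) i a v → drop i w ≡ a ∷ v → ∃[ j ] v ≡ drop (toℕ {suc (length w)} j) w
  next (a ∷ w) zero    b v eq = suc zero , sym (∷-injectiveʳ eq)
  next (a ∷ w) (suc i) b v eq = let j , eq′ = next w i b v eq in suc j , eq′

  L-∷ : ∀ i a v → a ∷ v ∈ L i ⇔ (∃[ j ] drop (toℕ i) w ≡ a ∷ drop (toℕ j) w × v ∈ L j)
  L-∷ i a v = mk⇔
    (λ eq → let j , v≡ = next w (toℕ i) a v eq in j , trans eq (cong (a ∷_) v≡) , sym v≡)
    (λ (j , eq , eq′) → trans eq (cong (a ∷_) eq′))

  singleton : ∀ v → (∃[ i ] i ≡ zero × v ∈ L i) ⇔ v ∈ ｛ w ｝
  singleton v = mk⇔ (λ { (_ , refl , eq) → eq }) (λ eq → zero , refl , eq)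

-- Concatenation and star

infixr 7 _∙_

_∙_ : Language A → Language A → Language A
(X ∙ Y) w = ∃[ u ] ∃[ v ] u ∈ X × v ∈ Y × u ++ v ≡ w

module _ (M : Automaton A) where
  open Automaton M

  AcceptsFrom : Fin states → Language A
  AcceptsFrom q w = foldl step q w ∈ˢ final

  -- Case distinction on whether the first factor is empty, which is possible exactly when `q` is
  -- final. Both the product and the star get their right-linear equations from it.
  acceptsFrom-∙-∷ : ∀ q a w → a ∷ w ∈ AcceptsFrom q ∙ Y ⇔
    (w ∈ AcceptsFrom (step q a) ∙ Y ⊎ (q ∈ˢ final × a ∷ w ∈ Y))
  acceptsFrom-∙-∷ q a w = mk⇔
    (λ { ([] , _ , q∈ , w∈ , refl) → inj₂ (q∈ , w∈)
       ; (_ ∷ u , v , u∈ , v∈ , refl) → inj₁ (u , v , u∈ , v∈ , refl) })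
    (λ { (inj₁ (u , v , u∈ , v∈ , refl)) → a ∷ u , v , u∈ , v∈ , refl
       ; (inj₂ (q∈ , w∈)) → [] , _ , q∈ , w∈ , refl })

∙-resp : {X X′ Y Y′ : Language A} → (∀ w → w ∈ X ⇔ w ∈ X′) → (∀ w → w ∈ Y ⇔ w ∈ Y′) →
         ∀ w → w ∈ X ∙ Y ⇔ w ∈ X′ ∙ Y′
∙-resp X⇔X′ Y⇔Y′ w = mk⇔
  (λ (u , v , u∈ , v∈ , eq) → u , v , to (X⇔X′ u) u∈ , to (Y⇔Y′ v) v∈ , eq)
  (λ (u , v , u∈ , v∈ , eq) → u , v , from (X⇔X′ u) u∈ , from (Y⇔Y′ v) v∈ , eq)

regular-∙ : Regular X → Regular Y → Regular (X ∙ Y)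
regular-∙ {X = X} {Y = Y} (M , X⇔M) (N , Y⇔N) =
  regular-resp initial⇔ (Powerset.regular (↔-sym +↔⊎) L ε? δ? L-∷ I?)
  where
  module M = Automaton M
  module N = Automaton N

  -- `inj₁` marks states still reading the first factor, `inj₂` those reading the second. Passing
  -- from one to the other reads no letter of its own: `δ` lets a final `p` take the first
  -- transition of `N` directly.
  L : Fin M.states ⊎ Fin N.states → Language _
  L (inj₁ p) = AcceptsFrom M p ∙ Accepts N
  L (inj₂ q) = AcceptsFrom N q

  ε? : Decidable (λ s → [] ∈ L s)
  ε? (inj₁ p) = map′ (λ (p∈ , q∈) → [] , [] , p∈ , q∈ , refl)
                     (λ { ([] , [] , p∈ , q∈ , refl) → p∈ , q∈ })
                     ((p ∈ˢ? M.final) ×-dec (N.initial ∈ˢ? N.final))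
  ε? (inj₂ q) = q ∈ˢ? N.final

  δ : Fin M.states ⊎ Fin N.states → _ → Pred (Fin M.states ⊎ Fin N.states) 0ℓ
  δ (inj₁ p) a s = inj₁ (M.step p a) ≡ s ⊎ (p ∈ˢ M.final × inj₂ (N.step N.initial a) ≡ s)
  δ (inj₂ q) a s = inj₂ (N.step q a) ≡ s

  infix 4 _≟_
  _≟_ : DecidableEquality (Fin M.states ⊎ Fin N.states)
  _≟_ = ⊎-≡-dec Fin._≟_ Fin._≟_

  δ? : ∀ s a → Decidable (δ s a)
  δ? (inj₁ p) a s = (inj₁ (M.step p a) ≟ s) ⊎-dec ((p ∈ˢ? M.final) ×-dec (inj₂ (N.step N.initial a) ≟ s))
  δ? (inj₂ q) a s = inj₂ (N.step q a) ≟ s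

  L-∷ : ∀ s a w → a ∷ w ∈ L s ⇔ (∃[ t ] δ s a t × w ∈ L t)
  L-∷ (inj₁ p) a w = mk⇔
    (λ aw∈ → case-⊎ (to (acceptsFrom-∙-∷ M p a w) aw∈))
    (λ { (_ , inj₁ refl , w∈) → from (acceptsFrom-∙-∷ M p a w) (inj₁ w∈)
       ; (_ , inj₂ (p∈ , refl) , w∈) → from (acceptsFrom-∙-∷ M p a w) (inj₂ (p∈ , w∈)) })
    where
    case-⊎ : _ ⊎ _ → _
    case-⊎ (inj₁ w∈) = _ , inj₁ refl , w∈
    case-⊎ (inj₂ (p∈ , w∈)) = _ , inj₂ (p∈ , refl) , w∈
  L-∷ (inj₂ q) a w = mk⇔ (λ w∈ → _ , refl , w∈) (λ { (_ , refl , w∈) → w∈ })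

  I? = _≟ inj₁ M.initial

  initial⇔ : ∀ w → (∃[ s ] s ≡ inj₁ M.initial × w ∈ L s) ⇔ w ∈ X ∙ Y
  initial⇔ w = mk⇔ (λ { (_ , refl , w∈) → from (X∙Y⇔ w) w∈ })
                   (λ w∈ → _ , refl , to (X∙Y⇔ w) w∈)
    where X∙Y⇔ = ∙-resp X⇔M Y⇔N

-- Empty factors at the front are skipped until one supplies the letter `a`.
star-∷ : ∀ a w → a ∷ w ∈ Star X → ∃[ u ] ∃[ v ] a ∷ u ∈ X × v ∈ Star X × u ++ v ≡ w
star-∷ a w ([] ∷ ws , _ ∷ ws∈ , eq) = star-∷ a w (ws , ws∈ , eq)
star-∷ a w ((_ ∷ u) ∷ ws , u∈ ∷ ws∈ , refl) = u , concat ws , u∈ , (ws , ws∈ , refl) , refl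

regular-Star : DecidableEquality A → {X : Language A} → Regular X → Regular (Star X)
regular-Star _≟_ {X} (M , X⇔M) =
  -- The automaton below recognizes X followed by X*, which lacks the empty word when X does; the
  -- singleton adds it.
  regular-resp ε∪X⁺⇔ (regular-∪ (regular-｛ _≟_ ｝ []) (Powerset.regular ↔-refl L ε? δ? L-∷ (Fin._≟ initial)))
  where
  open Automaton M

  -- What remains to be read inside the current factor, followed by any further factors. In `δ`, a
  -- final state may also restart from `initial` on the same letter.
  L : Fin states → Language _
  L q = AcceptsFrom M q ∙ Star X

  ε? : Decidable (λ q → [] ∈ L q)
  ε? q = map′ (λ q∈ → [] , [] , q∈ , ([] , [] , refl) , refl)
              (λ { ([] , [] , q∈ , _ , refl) → q∈ })
              (q ∈ˢ? final)

  δ : Fin states → _ → Pred (Fin states) 0ℓ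
  δ q a r = step q a ≡ r ⊎ (q ∈ˢ final × step initial a ≡ r)

  δ? : ∀ q a → Decidable (δ q a)
  δ? q a r = (step q a Fin.≟ r) ⊎-dec ((q ∈ˢ? final) ×-dec (step initial a Fin.≟ r))

  L-∷ : ∀ q a w → a ∷ w ∈ L q ⇔ (∃[ r ] δ q a r × w ∈ L r)
  L-∷ q a w = mk⇔ (λ aw∈ → ⇒ (to (acceptsFrom-∙-∷ M q a w) aw∈))
    (λ { (_ , inj₁ refl , w∈) → from (acceptsFrom-∙-∷ M q a w) (inj₁ w∈)
       ; (_ , inj₂ (q∈ , refl) , u , _ , u∈ , (vs , vs∈ , refl) , refl) →
           from (acceptsFrom-∙-∷ M q a w) (inj₂ (q∈ , (a ∷ u) ∷ vs , from (X⇔M (a ∷ u)) u∈ ∷ vs∈ , refl)) })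
    where
    ⇒ : w ∈ L (step q a) ⊎ (q ∈ˢ final × a ∷ w ∈ Star X) → ∃[ r ] δ q a r × w ∈ L r
    ⇒ (inj₁ w∈) = _ , inj₁ refl , w∈
    ⇒ (inj₂ (q∈ , aw∈)) = let u , v , u∈ , v∈ , eq = star-∷ a w aw∈ in
      _ , inj₂ (q∈ , refl) , u , v , to (X⇔M (a ∷ u)) u∈ , v∈ , eq

  ε∪X⁺⇔ : ∀ w → w ∈ ｛ [] ｝ ∪ (λ w → ∃[ q ] q ≡ initial × w ∈ L q) ⇔ w ∈ Star X
  ε∪X⁺⇔ w = mk⇔
    (λ { (inj₁ refl) → [] , [] , refl
       ; (inj₂ (_ , refl , u , _ , u∈ , (vs , vs∈ , refl) , refl)) → u ∷ vs , from (X⇔M u) u∈ ∷ vs∈ , refl })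
    (λ { ([] , [] , refl) → inj₁ refl
       ; (u ∷ us , u∈ ∷ us∈ , refl) → inj₂ (_ , refl , u , concat us , to (X⇔M u) u∈ , (us , us∈ , refl) , refl) })

-- Reachability and emptiness

module _ (A↔Fin : A ↔ Fin m) (M : Automaton A) where
  open Automaton M

  private
    -- A run of length at least the number of states visits some state twice;
    -- cutting out the loop shortens it.
    shorten : ∀ q w → states ≤ length w → ∃[ v ] length v < length w × foldl step q v ≡ foldl step q w
    shorten q w n≤∣w∣
      with i , j , i<j , eq ← pigeonhole (ℕ.n<1+n states) (λ i → foldl step q (take (toℕ i) w))
      = take (toℕ i) w ++ drop (toℕ j) w , shorter , same
      where
      open ≡-Reasoning
      j≤∣w∣ : toℕ j ≤ length w
      j≤∣w∣ = ℕ.≤-trans (s≤s⁻¹ (Fin.toℕ<n j)) n≤∣w∣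

      shorter : length (take (toℕ i) w ++ drop (toℕ j) w) < length w
      shorter = subst (_< length w)
        (sym (begin
          length (take (toℕ i) w ++ drop (toℕ j) w)            ≡⟨ length-++ (take (toℕ i) w) ⟩
          length (take (toℕ i) w) + length (drop (toℕ j) w)
            ≡⟨ cong₂ _+_ (trans (length-take (toℕ i) w) (ℕ.m≤n⇒m⊓n≡m (ℕ.≤-trans (ℕ.<⇒≤ i<j) j≤∣w∣))) (length-drop (toℕ j) w) ⟩
          toℕ i + (length w ∸ toℕ j)                           ∎))
        (subst (toℕ i + (length w ∸ toℕ j) <_) (ℕ.m+[n∸m]≡n j≤∣w∣) (ℕ.+-monoˡ-< (length w ∸ toℕ j) i<j))

      same : foldl step q (take (toℕ i) w ++ drop (toℕ j) w) ≡ foldl step q w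
      same = begin
        foldl step q (take (toℕ i) w ++ drop (toℕ j) w)             ≡⟨ foldl-++ step q (take (toℕ i) w) _ ⟩
        foldl step (foldl step q (take (toℕ i) w)) (drop (toℕ j) w) ≡⟨ cong (λ r → foldl step r (drop (toℕ j) w)) eq ⟩
        foldl step (foldl step q (take (toℕ j) w)) (drop (toℕ j) w) ≡⟨ foldl-++ step q (take (toℕ j) w) _ ⟨
        foldl step q (take (toℕ j) w ++ drop (toℕ j) w)             ≡⟨ cong (foldl step q) (take++drop≡id (toℕ j) w) ⟩
        foldl step q w                                              ∎

    short : ∀ q w → Acc _<_ (length w) → ∃[ v ] length v ≤ states × foldl step q v ≡ foldl step q w
    short q w (acc rec) with length w ℕ.≤? states
    ... | yes ∣w∣≤n = w , ∣w∣≤n , refl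
    ... | no  ∣w∣≰n =
      let v , v<w , v~w = shorten q w (ℕ.<⇒≤ (ℕ.≰⇒> ∣w∣≰n))
          u , u≤n , u~v = short q v (rec v<w)
      in u , u≤n , trans u~v v~w

  module _ {P : Pred (Fin states) 0ℓ} (P? : Decidable P) where

    private
      bounded? : ∀ l q → Dec (∃[ w ] length w ≤ l × P (foldl step q w))
      bounded? zero q = map′ (λ p → [] , z≤n , p) (λ { ([] , _ , p) → p }) (P? q)
      bounded? (suc l) q = map′
        (λ { (inj₁ p) → [] , z≤n , p ; (inj₂ (a , w , l , p)) → a ∷ w , s≤s l , p })
        (λ { ([] , _ , p) → inj₁ p ; (a ∷ w , s≤s l , p) → inj₂ (a , w , l , p) })
        (P? q ⊎-dec any-finite? A↔Fin (λ a → bounded? l (step q a)))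

    -- By `short`, every state reached by some word is reached by one no longer than the number of
    -- states, so a bounded search over the finite alphabet suffices.
    reachable? : ∀ q → Dec (∃[ w ] P (foldl step q w))
    reachable? q = map′ (λ (w , _ , p) → w , p)
      (λ (w , p) → let v , v≤n , v~w = short q w (<-wellFounded _) in v , v≤n , subst P (sym v~w) p)
      (bounded? states q)

nonempty? : A ↔ Fin m → {X : Language A} → Regular X → Dec (∃[ w ] w ∈ X)
nonempty? A↔Fin (M , X⇔M) =
  map′ (λ (w , w∈) → w , from (X⇔M w) w∈) (λ (w , w∈) → w , to (X⇔M w) w∈)
       (reachable? A↔Fin M (_∈ˢ? Automaton.final M) (Automaton.initial M))

-- Factors of a regular language

factor⇒ : {f w : List A} → Factor f w → ∃[ u ] ∃[ v ] u ++ f ++ v ≡ w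
factor⇒ f≤w with MkView u f≋ v ← Infix.toView f≤w
  rewrite Pointwise-≡⇒≡ f≋ = u , v , refl

factor⇐ : ∀ u {f v : List A} → Factor f (u ++ f ++ v)
factor⇐ u {f} {v} = Infix.fromView (MkView u (≡⇒Pointwise-≡ refl) v)

Factors : Language A → Language A
Factors X w = ∃[ v ] v ∈ X × Factor w v

-- The transitions of the automaton are kept; every accessible state becomes initial, to account for
-- the letters before the factor, and every state that can still reach a final one becomes final, to
-- account for those after it. Both sets are decided by `reachable?`.
regular-Factors : A ↔ Fin m → {X : Language A} → Regular X → Regular (Factors X)
regular-Factors A↔Fin {X} (M , X⇔M) =
  regular-resp initial⇔ (Powerset.regular ↔-refl L ε? δ? L-∷ (λ q → reachable? A↔Fin M (Fin._≟ q) initial))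
  where
  open Automaton M

  L : Fin states → Language _
  L q w = ∃[ v ] foldl step (foldl step q w) v ∈ˢ final

  ε? = reachable? A↔Fin M (_∈ˢ? final)
  δ? = λ q a r → step q a Fin.≟ r

  L-∷ : ∀ q a w → a ∷ w ∈ L q ⇔ (∃[ r ] step q a ≡ r × w ∈ L r)
  L-∷ q a w = mk⇔ (λ w∈ → _ , refl , w∈) (λ { (_ , refl , w∈) → w∈ })

  foldl-++₃ : ∀ u w v → foldl step (foldl step (foldl step initial u) w) v ≡ foldl step initial (u ++ w ++ v)
  foldl-++₃ u w v = sym (trans (foldl-++ step initial u (w ++ v)) (foldl-++ step (foldl step initial u) w v))

  initial⇔ : ∀ w → (∃[ q ] (∃[ u ] foldl step initial u ≡ q) × w ∈ L q) ⇔ w ∈ Factors X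
  initial⇔ w = mk⇔
    (λ { (_ , (u , refl) , v , run∈) →
         u ++ w ++ v , from (X⇔M (u ++ w ++ v)) (subst (_∈ˢ final) (foldl-++₃ u w v) run∈) , factor⇐ u })
    (λ (x , x∈ , f) → let u , v , eq = factor⇒ f in
       foldl step initial u , (u , refl) , v ,
       subst (_∈ˢ final) (sym (foldl-++₃ u w v)) (to (X⇔M (u ++ w ++ v)) (subst (_∈ X) (sym eq) x∈)))

-- Completion of a code with an unbordered word

-- One half of Levi's lemma on two factorizations of the same word.
++-split : ∀ (xs ys : List A) {us vs} → xs ++ us ≡ ys ++ vs → length xs ≤ length ys →
           ∃[ zs ] xs ++ zs ≡ ys × us ≡ zs ++ vs
++-split [] ys eq _ = ys , refl , eq
++-split (x ∷ xs) (y ∷ ys) eq (s≤s le)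
  with refl , eq′ ← ∷-injective eq
  with zs , refl , eq″ ← ++-split xs ys eq′ le = zs , refl , eq″

length≡0⇒[] : ∀ (xs : List A) → length xs ≡ 0 → xs ≡ []
length≡0⇒[] [] _ = refl

star-[] : [] ∈ Star X
star-[] = [] , [] , refl

star-∷⁺ : ∀ {u v : List A} → u ∈ X → v ∈ Star X → u ++ v ∈ Star X
star-∷⁺ u∈ (vs , vs∈ , refl) = _ ∷ vs , u∈ ∷ vs∈ , refl

star-++ : ∀ {u v : List A} → u ∈ Star X → v ∈ Star X → u ++ v ∈ Star X
star-++ (us , us∈ , refl) (vs , vs∈ , refl) = us ++ vs , ++⁺ us∈ vs∈ , sym (concat-++ us vs)

star-mono : {X Y : Language A} → X ⊆ Y → Star X ⊆ Star Y
star-mono X⊆Y (ws , ws∈ , eq) = ws , All.map X⊆Y ws∈ , eq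

prefix⇒ : {f w : List A} → Prefix _≡_ f w → ∃[ v ] f ++ v ≡ w
prefix⇒ p with f≋ Prefix.++ v ← Prefix.toView p rewrite Pointwise-≡⇒≡ f≋ = v , refl

-- `unbordered` is phrased through overlaps: no two occurrences of `y` start at a distance strictly
-- between 0 and the length of `y`.
module Completion
  {A : Set} (X : Language A) (code-X : Code X) (star-X? : Decidable (Star X)) (_≟_ : DecidableEquality A)
  (y : List A) (y≢[] : y ≢ [])
  (unbordered : ∀ d r r′ → y ++ r ≡ d ++ y ++ r′ → 0 < length d → length d < length y → ⊥)
  (y∤star-X : ∀ {v} → v ∈ Star X → ¬ Factor y v)
  where

  -- The set U of the construction; `Added` is then y(Uy)*.
  Filler : Language A
  Filler = ∁ (Star X ∪ Factor y)

  Added : Language A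
  Added = ｛ y ｝ ∙ Star (Filler ∙ ｛ y ｝)

  Z : Language A
  Z = X ∪ Added

  private
    -- Suppose `c′` extends `c` by a nonempty `d`. If `d` is shorter than `y`, the two occurrences
    -- of `y` overlap, against `unbordered`; otherwise the occurrence after `c` lies inside `c′`,
    -- which has none.
    occurrence-≤ : ∀ c c′ {r r′} → ¬ Factor y c′ → c ++ y ++ r ≡ c′ ++ y ++ r′ → length c′ ≤ length c
    occurrence-≤ c c′ {r} {r′} y∤c′ eq with length c′ ℕ.≤? length c
    ... | yes c′≤c = c′≤c
    ... | no  c′≰c
      with d , refl , eq′ ← ++-split c c′ eq (ℕ.<⇒≤ (ℕ.≰⇒> c′≰c))
      with length y ℕ.≤? length d
    ... | no  y≰d = contradiction (ℕ.≰⇒> y≰d) (unbordered d r r′ eq′ (0<d d c′≰c))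
      where
      0<d : ∀ d → ¬ length (c ++ d) ≤ length c → 0 < length d
      0<d [] c≰ = contradiction (ℕ.≤-reflexive (cong length (++-identityʳ c))) c≰
      0<d (_ ∷ _) _ = z<s
    ... | yes y≤d with e , refl , _ ← ++-split y d eq′ y≤d = contradiction (factor⇐ c) y∤c′

  -- The deciphering rule for `Z`: a `y` preceded by a word without factor `y` is the leftmost one,
  -- so the word itself determines where it stands.
  first-occurrence : ∀ c c′ {r r′} → ¬ Factor y c → ¬ Factor y c′ → c ++ y ++ r ≡ c′ ++ y ++ r′ →
                     c ≡ c′ × r ≡ r′
  first-occurrence c c′ {r} {r′} y∤c y∤c′ eq
    with c′≤c ← occurrence-≤ c c′ y∤c′ eq | c≤c′ ← occurrence-≤ c′ c y∤c (sym eq)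
    with d , refl , eq′ ← ++-split c c′ eq c≤c′
    -- `c` and `c′` have equal length, so the overhang `d` is empty.
    with refl ← length≡0⇒[] d (ℕ.n≤0⇒n≡0 (ℕ.+-cancelˡ-≤ (length c) _ _
           (ℕ.≤-trans (ℕ.≤-reflexive (sym (length-++ c))) (ℕ.≤-trans c′≤c (ℕ.≤-reflexive (sym (ℕ.+-identityʳ _)))))))
    = sym (++-identityʳ c) , ++-cancelˡ y r r′ eq′

  -- A factorization over `Z`, cut at its words from `Added`. The words of X in `gs` concatenate to
  -- a word without factor `y`, so the `y` that follows them is the first one and `first-occurrence`
  -- applies.
  data Blocks : List (List A) → Set where
    end   : ∀ {gs} → All X gs → Blocks gs
    block : ∀ {gs ws zs} → All X gs → All (Filler ∙ ｛ y ｝) ws → Blocks zs →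
            Blocks (gs ++ (y ++ concat ws) ∷ zs)

  private
    blocks : ∀ {zs} → All Z zs → Blocks zs
    blocks [] = end []
    blocks (inj₁ z∈ ∷ zs∈) with blocks zs∈
    ... | end gs∈ = end (z∈ ∷ gs∈)
    ... | block gs∈ ws∈ bs = block (z∈ ∷ gs∈) ws∈ bs
    blocks (inj₂ (_ , _ , refl , (_ , ws∈ , refl) , refl) ∷ zs∈) = block [] ws∈ (blocks zs∈)

    concat-block : ∀ (gs ws zs : List (List A)) →
      concat (gs ++ (y ++ concat ws) ∷ zs) ≡ concat gs ++ y ++ concat ws ++ concat zs
    concat-block gs ws zs = begin
      concat (gs ++ (y ++ concat ws) ∷ zs)            ≡⟨ concat-++ gs _ ⟨
      concat gs ++ (y ++ concat ws) ++ concat zs      ≡⟨ cong (concat gs ++_) (++-assoc y (concat ws) (concat zs)) ⟩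
      concat gs ++ y ++ concat ws ++ concat zs        ∎
      where open ≡-Reasoning

    y∤concat : ∀ {gs} → All X gs → ¬ Factor y (concat gs)
    y∤concat gs∈ = y∤star-X (_ , gs∈ , refl)

    -- In a product of words of `Z`, what precedes the first `y` lies in X*, and a filler does not.
    -- This decides whether an added word goes on or has ended.
    ≢-filler : ∀ {u zs} r → u ∈ Filler → Blocks zs → u ++ y ++ r ≢ concat zs
    ≢-filler {u} r u∈ (end gs∈) eq = y∤concat gs∈ (subst (Factor y) eq (factor⇐ u))
    ≢-filler {u} r u∈ (block {gs} {ws} {zs} gs∈ ws∈ bs) eq
      with refl , _ ← first-occurrence u (concat gs) (u∈ ∘ inj₂) (y∤concat gs∈) (trans eq (concat-block gs ws zs))
      = u∈ (inj₁ (gs , gs∈ , refl))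

    assoc₄ : ∀ u v zs → ((u ++ y) ++ v) ++ concat zs ≡ u ++ y ++ v ++ concat zs
    assoc₄ u v zs = trans (++-assoc (u ++ y) v (concat zs)) (++-assoc u y (v ++ concat zs))

    -- Fillers are peeled off in parallel by `first-occurrence`; if one side runs out before the
    -- other, `≢-filler` gives a contradiction. Equality of the concatenations is the right
    -- conclusion, since the letter of the factorization over `Z` is `y ++ concat ws`.
    unique-fillers : ∀ {ws ws′ zs zs′} → All (Filler ∙ ｛ y ｝) ws → All (Filler ∙ ｛ y ｝) ws′ →
      Blocks zs → Blocks zs′ → concat ws ++ concat zs ≡ concat ws′ ++ concat zs′ →
      concat ws ≡ concat ws′ × concat zs ≡ concat zs′
    unique-fillers [] [] _ _ eq = refl , eq
    unique-fillers {ws′ = _ ∷ ws′} {zs′ = zs′} [] ((u , _ , u∈ , refl , refl) ∷ _) bs _ eq =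
      contradiction (sym (trans eq (assoc₄ u (concat ws′) zs′))) (≢-filler _ u∈ bs)
    unique-fillers {ws = _ ∷ ws} {zs = zs} ((u , _ , u∈ , refl , refl) ∷ _) [] _ bs′ eq =
      contradiction (trans (sym (assoc₄ u (concat ws) zs)) eq) (≢-filler _ u∈ bs′)
    unique-fillers {_ ∷ ws} {_ ∷ ws′} {zs} {zs′}
      ((u , _ , u∈ , refl , refl) ∷ ws∈) ((u′ , _ , u∈′ , refl , refl) ∷ ws∈′) bs bs′ eq
      with refl , eq′ ← first-occurrence u u′ (u∈ ∘ inj₂) (u∈′ ∘ inj₂)
             (trans (sym (assoc₄ u (concat ws) zs)) (trans eq (assoc₄ u′ (concat ws′) zs′)))
      with eq₁ , eq₂ ← unique-fillers ws∈ ws∈′ bs bs′ eq′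
      = cong ((u ++ y) ++_) eq₁ , eq₂

    end≢block : ∀ {gs hs ws zs} → All X gs → concat gs ≢ concat (hs ++ (y ++ concat ws) ∷ zs)
    end≢block {hs = hs} {ws} {zs} gs∈ eq =
      y∤concat gs∈ (subst (Factor y) (sym (trans eq (concat-block hs ws zs))) (factor⇐ (concat hs)))

    -- The first `y` separates the leading words of X, unique because X is a code, from an added
    -- word whose end is found by `unique-fillers`; the rest is induction.
    unique-blocks : ∀ {xs ys} → Blocks xs → Blocks ys → concat xs ≡ concat ys → xs ≡ ys
    unique-blocks (end gs∈) (end gs∈′) eq = code-X _ _ gs∈ gs∈′ eq
    unique-blocks (end gs∈) (block {gs} {ws} {zs} _ _ _) eq =
      contradiction eq (end≢block {hs = gs} {ws} {zs} gs∈)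
    unique-blocks (block {gs} {ws} {zs} _ _ _) (end gs∈) eq =
      contradiction (sym eq) (end≢block {hs = gs} {ws} {zs} gs∈)
    unique-blocks (block {gs} {ws} {zs} gs∈ ws∈ bs) (block {gs′} {ws′} {zs′} gs∈′ ws∈′ bs′) eq
      with eq₁ , eq₂ ← first-occurrence (concat gs) (concat gs′) (y∤concat gs∈) (y∤concat gs∈′)
             (trans (sym (concat-block gs ws zs)) (trans eq (concat-block gs′ ws′ zs′)))
      with eq₃ , eq₄ ← unique-fillers ws∈ ws∈′ bs bs′ eq₂
      = cong₂ _++_ (code-X gs gs′ gs∈ gs∈′ eq₁) (cong₂ _∷_ (cong (y ++_) eq₃) (unique-blocks bs bs′ eq₄))

  code : Code Z
  code xs ys xs∈ ys∈ = unique-blocks (blocks xs∈) (blocks ys∈)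

  private
    y∤[] : ¬ Factor y []
    y∤[] (here p) = let v , eq = prefix⇒ p in y≢[] (++-conicalˡ y v eq)

    first-occurrence? : ∀ v → ¬ Factor y v ⊎ (∃[ u ] ∃[ v′ ] ¬ Factor y u × u ++ y ++ v′ ≡ v)
    first-occurrence? [] = inj₁ y∤[]
    first-occurrence? (c ∷ v) with prefix? _≟_ y (c ∷ v)
    ... | yes p = let v′ , eq = prefix⇒ p in inj₂ ([] , v′ , y∤[] , eq)
    ... | no ¬p with first-occurrence? v
    ...   | inj₁ y∤v = inj₁ λ { (here p) → ¬p p ; (there f) → y∤v f }
    ...   | inj₂ (u , v′ , y∤u , refl) =
      inj₂ (c ∷ u , v′ , (λ { (here p) → ¬p (p ++ᵖ (y ++ v′)) ; (there f) → y∤u f }) , refl)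

    star-XZ : Star X ⊆ Star Z
    star-XZ = star-mono inj₁

    added : ∀ {v} → v ∈ Star (Filler ∙ ｛ y ｝) → y ++ v ∈ Z
    added {v} v∈ = inj₂ (y , v , refl , v∈ , refl)

    y∈Star-Z : y ∈ Star Z
    y∈Star-Z = subst (_∈ Star Z) (trans (++-identityʳ _) (++-identityʳ y)) (star-∷⁺ (added star-[]) star-[])

    filler : ∀ {u} → u ∈ Filler → u ++ y ∈ Star (Filler ∙ ｛ y ｝)
    filler {u} u∈ = subst (_∈ Star _) (++-identityʳ (u ++ y)) (star-∷⁺ (u , y , u∈ , refl , refl) star-[])

    shorter : ∀ u v → length v < length (u ++ y ++ v)
    shorter u v rewrite length-++ u {y ++ v} | length-++ y {v} =
      ℕ.<-≤-trans (ℕ.m<n+m (length v) (ℕ.n≢0⇒n>0 (y≢[] ∘ length≡0⇒[] y))) (ℕ.m≤n+m _ (length u))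

    -- Deciphers `v ++ y` as it stands behind an opening `y`: `t` continues the added word begun
    -- there, `r` is the remainder over `Z`. Let `u` be the part of `v` before its first `y`. If `u`
    -- is outside X*, it is a filler and prolongs the added word; if it is in X*, the added word
    -- ends, `u` is read over X, and the next `y` opens a new added word.
    absorb : ∀ v → Acc _<_ (length v) →
      ∃[ t ] ∃[ r ] t ∈ Star (Filler ∙ ｛ y ｝) × r ∈ Star Z × t ++ r ≡ v ++ y
    absorb v _ with first-occurrence? v | star-X? v
    absorb v _ | inj₁ _   | yes v∈ = [] , v ++ y , star-[] , star-++ (star-XZ v∈) y∈Star-Z , refl
    absorb v _ | inj₁ y∤v | no v∉ =
      v ++ y , [] , filler (λ { (inj₁ v∈) → v∉ v∈ ; (inj₂ y∣v) → y∤v y∣v }) , star-[] , ++-identityʳ (v ++ y)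
    absorb v (acc rec) | inj₂ (u , v′ , y∤u , refl) | _
      with t , r , t∈ , r∈ , eq ← absorb v′ (rec (shorter u v′)) | star-X? u
    ... | yes u∈ = [] , u ++ (y ++ t) ++ r , star-[] , star-++ (star-XZ u∈) (star-∷⁺ (added t∈) r∈) , eq′
      where
      eq′ : u ++ (y ++ t) ++ r ≡ (u ++ y ++ v′) ++ y
      eq′ = trans (cong (u ++_) (trans (++-assoc y t r) (trans (cong (y ++_) eq) (sym (++-assoc y v′ y)))))
                  (sym (++-assoc u (y ++ v′) y))
    ... | no u∉ = (u ++ y) ++ t , r , star-++ (filler (λ { (inj₁ u∈) → u∉ u∈ ; (inj₂ y∣u) → y∤u y∣u })) t∈ , r∈ ,
      trans (++-assoc (u ++ y) t r) (trans (cong ((u ++ y) ++_) eq)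
        (trans (sym (++-assoc (u ++ y) v′ y)) (cong (_++ y) (++-assoc u y v′))))

  complete : Complete Z
  complete v with t , r , t∈ , r∈ , eq ← absorb v (<-wellFounded _) =
    -- The left `y` opens an added word, and the right one closes whatever filler is pending at the
    -- end of `v`.
    y ++ v ++ y ,
    subst (_∈ Star Z) (trans (++-assoc y t r) (cong (y ++_) eq)) (star-∷⁺ (added t∈) r∈) ,
    factor⇐ y

-- The marker y and the factor distance

++-replicate⁻ : ∀ n (d : List A) {e} → d ++ e ≡ replicate n x →
                d ≡ replicate (length d) x × e ≡ replicate (length e) x
++-replicate⁻ n [] refl = refl , cong (λ l → replicate l _) (sym (length-replicate n))
++-replicate⁻ (suc n) (_ ∷ d) eq
  with refl , eq′ ← ∷-injective eq
  with d≡ , e≡ ← ++-replicate⁻ n d eq′ = cong (_ ∷_) d≡ , e≡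

-- At position `length e` the left word has `a`, the right one `b`.
replicate-≢ : a ≢ b → ∀ n e {u v : List A} → length e < n → replicate n a ++ u ≢ e ++ b ∷ v
replicate-≢ a≢b (suc n) [] _ eq = a≢b (∷-injectiveˡ eq)
replicate-≢ a≢b (suc n) (_ ∷ e) (s≤s e<n) eq = replicate-≢ a≢b n e e<n (∷-injectiveʳ eq)

-- The letter of `f` at position `length e` would be `b` by the first equation and `a` by the
-- second.
replicate-≢-prefix : a ≢ b → ∀ n e f {t t′ u v : List A} → length e < n → length e < length f →
  f ++ t ≡ e ++ b ∷ u → f ++ t′ ≢ replicate n a ++ v
replicate-≢-prefix a≢b (suc n) [] (_ ∷ f) _ _ eq eq′ =
  a≢b (trans (sym (∷-injectiveˡ eq′)) (∷-injectiveˡ eq))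
replicate-≢-prefix a≢b (suc n) (_ ∷ e) (_ ∷ f) (s≤s e<n) (s≤s e<f) eq eq′ =
  replicate-≢-prefix a≢b n e f e<n e<f (∷-injectiveʳ eq) (∷-injectiveʳ eq′)

-- The letter b that ends the initial run of a's pins down the position of a long
-- common factor f.
same-offset : a ≢ b → ∀ M f s s′ {t t′ u u′ : List A} →
  s ++ f ++ t ≡ replicate M a ++ b ∷ u → s′ ++ f ++ t′ ≡ replicate M a ++ b ∷ u′ →
  length s ≤ M → length s′ ≤ M → M < length f → s ≡ s′
same-offset {a = a} a≢b M f s s′ eq eq′ s≤M s′≤M M<f
  -- `e` and `e′` are the parts of the run of a's left after `s` and `s′`. They have at most `M`
  -- letters and `f` has more, so `f` begins with `e` followed by `b`, and likewise with `e′`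
  -- followed by `b`; unequal lengths would clash inside `f`.
  with e  , se≡  , ft≡  ← ++-split s  (replicate M a) eq  (subst (length s  ≤_) (sym (length-replicate M)) s≤M)
  with e′ , s′e≡ , ft′≡ ← ++-split s′ (replicate M a) eq′ (subst (length s′ ≤_) (sym (length-replicate M)) s′≤M)
  with e≡  ← proj₂ (++-replicate⁻ M s se≡) | e′≡ ← proj₂ (++-replicate⁻ M s′ s′e≡)
  = ++-cancelʳ _ s s′ (trans se≡ (trans (sym s′e≡) (cong (s′ ++_) (sym e≡e′))))
  where
  ≤M : ∀ s {e} → s ++ e ≡ replicate M a → length e ≤ M
  ≤M s {e} refl′ = ℕ.≤-trans (ℕ.m≤n+m (length e) (length s))
    (ℕ.≤-reflexive (trans (sym (length-++ s)) (trans (cong length refl′) (length-replicate M))))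
  e≡e′ : e ≡ e′
  e≡e′ with ℕ.<-cmp (length e) (length e′)
  ... | tri< lt _ _ = contradiction (trans ft′≡ (cong (_++ _) e′≡))
          (replicate-≢-prefix a≢b (length e′) e f lt (ℕ.≤-<-trans (≤M s se≡) M<f) ft≡)
  ... | tri≈ _ eq _ = trans e≡ (trans (cong (λ l → replicate l a) eq) (sym e′≡))
  ... | tri> _ _ gt = contradiction (trans ft≡ (cong (_++ _) e≡))
          (replicate-≢-prefix a≢b (length e) e′ f gt (ℕ.≤-<-trans (≤M s′ s′e≡) M<f) ft′≡)

replicate-∷ʳ : ∀ n (x : A) → replicate n x ∷ʳ x ≡ x ∷ replicate n x
replicate-∷ʳ zero x = refl
replicate-∷ʳ (suc n) x = cong (x ∷_) (replicate-∷ʳ n x)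

reverse-replicate : ∀ n (x : A) → reverse (replicate n x) ≡ replicate n x
reverse-replicate zero x = refl
reverse-replicate (suc n) x =
  trans (unfold-reverse x (replicate n x)) (trans (cong (_∷ʳ x) (reverse-replicate n x)) (replicate-∷ʳ n x))

-- The mirror image of `same-offset`: reversal exchanges the roles of `a` and `b`, and of prefixes
-- and suffixes.
same-offsetʳ : a ≢ b → ∀ M f s s′ t t′ {u u′ : List A} →
  s ++ f ++ t ≡ u ++ a ∷ replicate M b → s′ ++ f ++ t′ ≡ u′ ++ a ∷ replicate M b →
  length t ≤ M → length t′ ≤ M → M < length f → t ≡ t′
same-offsetʳ {a = a} {b} a≢b M f s s′ t t′ eq eq′ t≤M t′≤M M<f =
  reverse-injective (same-offset (a≢b ∘ sym) M (reverse f) (reverse t) (reverse t′)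
    (reversed s t eq) (reversed s′ t′ eq′)
    (subst (_≤ M) (sym (length-reverse t)) t≤M) (subst (_≤ M) (sym (length-reverse t′)) t′≤M)
    (subst (M <_) (sym (length-reverse f)) M<f))
  where
  open ≡-Reasoning
  reversed : ∀ s t {u} → s ++ f ++ t ≡ u ++ a ∷ replicate M b →
             reverse t ++ reverse f ++ reverse s ≡ replicate M b ++ a ∷ reverse u
  reversed s t {u} eq = begin
    reverse t ++ reverse f ++ reverse s     ≡⟨ ++-assoc (reverse t) (reverse f) (reverse s) ⟨
    (reverse t ++ reverse f) ++ reverse s   ≡⟨ cong (_++ reverse s) (reverse-++ f t) ⟨
    reverse (f ++ t) ++ reverse s           ≡⟨ reverse-++ s (f ++ t) ⟨
    reverse (s ++ f ++ t)                   ≡⟨ cong reverse eq ⟩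
    reverse (u ++ a ∷ replicate M b)        ≡⟨ reverse-++ u (a ∷ replicate M b) ⟩
    reverse (a ∷ replicate M b) ++ reverse u ≡⟨ cong (_++ reverse u) (unfold-reverse a (replicate M b)) ⟩
    (reverse (replicate M b) ∷ʳ a) ++ reverse u ≡⟨ ++-assoc (reverse (replicate M b)) [ a ] (reverse u) ⟩
    reverse (replicate M b) ++ a ∷ reverse u ≡⟨ cong (_++ a ∷ reverse u) (reverse-replicate M b) ⟩
    replicate M b ++ a ∷ reverse u          ∎

++-length-antitone : ∀ (xs ys : List A) {us vs} → xs ++ us ≡ ys ++ vs → length us ≤ length vs →
                     length ys ≤ length xs
++-length-antitone xs ys {us} {vs} eq us≤vs = ℕ.+-cancelʳ-≤ (length us) _ _ (begin
  length ys + length us  ≤⟨ ℕ.+-monoʳ-≤ (length ys) us≤vs ⟩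
  length ys + length vs  ≡⟨ length-++ ys ⟨
  length (ys ++ vs)      ≡⟨ cong length eq ⟨
  length (xs ++ us)      ≡⟨ length-++ xs ⟩
  length xs + length us  ∎)
  where open ℕ.≤-Reasoning

factor-within : ∀ s f t p w q → s ++ f ++ t ≡ p ++ w ++ q → length s ≤ length p → length t ≤ length q →
                Factor {A} w f
factor-within s f t p w q eq s≤p t≤q
  with p′ , refl , eq′ ← ++-split s p eq s≤p
  with pwq≡ ← trans (++-assoc p′ w q) (sym eq′)
  with e , refl , _ ← ++-split (p′ ++ w) f pwq≡ (++-length-antitone f (p′ ++ w) (sym pwq≡) t≤q)
  = subst (Factor w) (sym (++-assoc p′ w e)) (factor⇐ p′)

record Close (k : ℕ) (w w′ : List A) : Set where
  constructor close
  field
    s f t s′ t′ : List A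
    w≡  : s ++ f ++ t ≡ w
    w′≡ : s′ ++ f ++ t′ ≡ w′
    ≤k  : length s + length t ≤ k
    ≤k′ : length s′ + length t′ ≤ k

-- The quantity |w| + |w′| - 2|f| counts the letters around `f` in both words together, so each word
-- has at most `k` of them.
𝓕⇒Close : ∀ {k} {w w′ : List A} → 𝓕 k w w′ → Close k w w′
𝓕⇒Close {k = k} (f , (f≤w , f≤w′ , _) , d≤k)
  with s , t , refl ← factor⇒ f≤w
  with s′ , t′ , refl ← factor⇒ f≤w′
  = close s f t s′ t′ refl refl (ℕ.m+n≤o⇒m≤o (length s + length t) rest≤k) (ℕ.m+n≤o⇒n≤o (length s + length t) rest≤k)
  where
  rearrange : ∀ s f t s′ t′ → (s + (f + t)) + (s′ + (f + t′)) ≡ 2 * f + ((s + t) + (s′ + t′))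
  rearrange = solve-∀
  length₃ : ∀ (s t : List _) → length (s ++ f ++ t) ≡ length s + (length f + length t)
  length₃ s t = trans (length-++ s) (cong (length s +_) (length-++ f))
  rest≤k : (length s + length t) + (length s′ + length t′) ≤ k
  rest≤k = subst (_≤ k)
    (trans (cong (_∸ 2 * length f) (trans (cong₂ _+_ (length₃ s t) (length₃ s′ t′))
             (rearrange (length s) (length f) (length t) (length s′) (length t′))))
           (ℕ.m+n∸m≡n (2 * length f) _)) d≤k

module Marker {A : Set} {a b : A} (a≢b : a ≢ b) (w : List A) (M : ℕ) (∣w∣+2≤M : length w + 2 ≤ M) where

  y : List A
  y = replicate M a ++ b ∷ w ++ a ∷ replicate M b

  private
    p : List A
    p = replicate M a ++ b ∷ w ++ [ a ]

    y≡p++bᴹ : y ≡ p ++ replicate M b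
    y≡p++bᴹ = trans (cong (λ v → replicate M a ++ b ∷ v) (sym (++-assoc w [ a ] (replicate M b))))
                    (sym (++-assoc (replicate M a) (b ∷ w ++ [ a ]) (replicate M b)))

    0<M : 0 < M
    0<M = ℕ.≤-trans (s≤s z≤n) (ℕ.≤-trans (ℕ.m≤n+m 2 (length w)) ∣w∣+2≤M)

    ∣p∣≡ : length p ≡ M + (length w + 2)
    ∣p∣≡ = trans (length-++ (replicate M a)) (cong₂ _+_ (length-replicate M)
      (trans (cong suc (length-++ w)) (sym (ℕ.+-suc (length w) 1))))

    ∣y∣≡ : length y ≡ length p + M
    ∣y∣≡ = trans (cong length y≡p++bᴹ) (trans (length-++ p) (cong (length p +_) (length-replicate M)))

    y≢ : ∀ e {r v} → length e < M → y ++ r ≢ e ++ b ∷ v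
    y≢ e {r} e<M eq = replicate-≢ a≢b M e e<M (trans (sym (++-assoc (replicate M a) _ r)) eq)

    length-+ : ∀ (d : List A) {e v} → d ++ e ≡ v → length d + length e ≡ length v
    length-+ d refl = sym (length-++ d)

    nonempty : ∀ n → 0 < n → replicate n b ≡ b ∷ replicate (n ∸ 1) b
    nonempty (suc n) _ = refl

    e<∣bᴹ∣ : ∀ e → length (p ++ e) < length y → length e < length (replicate M b)
    e<∣bᴹ∣ e lt = ℕ.+-cancelˡ-< (length p) _ _
      (subst₂ _<_ (length-++ p) (trans (cong length y≡p++bᴹ) (length-++ p)) lt)

  y++ : ∀ r → y ++ r ≡ replicate M a ++ b ∷ w ++ a ∷ replicate M b ++ r
  y++ r = trans (++-assoc (replicate M a) _ r)
                (cong (λ v → replicate M a ++ b ∷ v) (++-assoc w (a ∷ replicate M b) r))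

  2M<∣y∣ : M + M < length y
  2M<∣y∣ = subst (M + M <_) (sym ∣y∣≡)
    (ℕ.+-monoˡ-< M (subst (M <_) (sym ∣p∣≡) (ℕ.m<m+n M (ℕ.≤-trans (s≤s z≤n) (ℕ.m≤n+m 2 (length w))))))

  y≢[] : y ≢ []
  y≢[] eq = ℕ.n≮0 (subst (M + M <_) (cong length eq) 2M<∣y∣)

  -- Let `p` be `y` without its final run of b's. If the shift `d` ends within the opening run,
  -- fewer than `M` a's are left before the next `b`, while the shifted `y` needs `M` of them. If it
  -- ends later but within `p`, fewer than `M` letters of `p` remain, because |p| = M + |w| + 2 is
  -- at most 2M, and the `b` after them falls on the opening run of the shifted copy. If it ends in
  -- the final run, the shifted copy would begin with `b`.
  unbordered : ∀ d r r′ → y ++ r ≡ d ++ y ++ r′ → 0 < length d → length d < length y → ⊥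
  unbordered d r r′ eq 0<d d<y with length d ℕ.≤? M | length d ℕ.≤? length p
  ... | yes d≤M | _
    with e , de≡ , yr′≡ ← ++-split d (replicate M a) (trans (sym eq) (++-assoc (replicate M a) _ r))
           (subst (length d ≤_) (sym (length-replicate M)) d≤M)
    = y≢ e (subst (length e <_) (trans (length-+ d de≡) (length-replicate M)) (ℕ.m<n+m (length e) 0<d)) yr′≡
  ... | no M<d | yes d≤p
    with e , de≡ , yr′≡ ← ++-split d p (trans (sym eq) (trans (cong (_++ r) y≡p++bᴹ) (++-assoc p (replicate M b) r))) d≤p
    = y≢ e e<M (trans yr′≡ (cong (λ v → e ++ v ++ r) (nonempty M 0<M)))
    where
    e<M : length e < M
    e<M = ℕ.+-cancelˡ-< (length d) _ _ (begin-strict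
      length d + length e  ≡⟨ trans (length-+ d de≡) ∣p∣≡ ⟩
      M + (length w + 2)   ≤⟨ ℕ.+-monoʳ-≤ M ∣w∣+2≤M ⟩
      M + M                <⟨ ℕ.+-monoˡ-< M (ℕ.≰⇒> M<d) ⟩
      length d + M         ∎)
      where open ℕ.≤-Reasoning
  ... | no _ | no p≰d
    with e , refl , eq′ ← ++-split p d (trans (sym (trans (cong (_++ r) y≡p++bᴹ) (++-assoc p (replicate M b) r))) eq)
           (ℕ.<⇒≤ (ℕ.≰⇒> p≰d))
    with e′ , ee′≡ , yr′≡ ← ++-split e (replicate M b) (sym eq′) (ℕ.<⇒≤ (e<∣bᴹ∣ e d<y))
    = y≢ [] 0<M (trans yr′≡ (cong (_++ r) (trans (proj₂ (++-replicate⁻ M e ee′≡)) (nonempty (length e′) (0<∣e′∣)))))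
    where
    open ℕ.≤-Reasoning
    0<∣e′∣ : 0 < length e′
    0<∣e′∣ = ℕ.+-cancelˡ-< (length e) _ _ (begin-strict
      length e + 0          ≡⟨ ℕ.+-identityʳ (length e) ⟩
      length e              <⟨ e<∣bᴹ∣ e d<y ⟩
      length (replicate M b) ≡⟨ length-+ e ee′≡ ⟨
      length e + length e′  ∎)

-- Embedding into a complete independent code

module _ {A : Set} {m : ℕ} (A↔Fin : A ↔ Fin m) where

  ≟-finite : DecidableEquality A
  ≟-finite = Fin.inj⇒≟ (↔⇒↣ A↔Fin)

  two-letters : 2 ≤ m → Σ[ a ∈ A ] Σ[ b ∈ A ] a ≢ b
  two-letters (s≤s (s≤s _)) = F.from zero , F.from (suc zero) , λ eq →
    Fin.0≢1+n (trans (sym (F.strictlyInverseˡ zero)) (trans (cong F.to eq) (F.strictlyInverseˡ (suc zero))))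
    where module F = Inverse A↔Fin

regular-Factor : DecidableEquality A → ∀ (y : List A) → Regular (Factor y)
regular-Factor _≟_ y = regular-resp
  (λ v → mk⇔ (λ { (u , _ , _ , (_ , v , refl , _ , refl) , refl) → factor⇐ u })
             (λ f → let u , v , eq = factor⇒ f in u , y ++ v , tt , (y , v , refl , tt , refl) , eq))
  (regular-∙ regular-U (regular-∙ (regular-｛ _≟_ ｝ y) regular-U))

module Embedding
  {A : Set} (_≟_ : DecidableEquality A) {a b : A} (a≢b : a ≢ b) (k : ℕ)
  {X : Language A} (regular-X : Regular X) (code-X : Code X)
  (independent-X : Independent (antireflexive (𝓕 k)) X)
  (w : List A) (w∉ : w ∉ Factors (Star X))
  where

  -- At least `k`, so that deleting `k` letters at an end stays within a run of `y`; at least |w| +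
  -- 2, as `Marker` requires for unborderedness.
  M : ℕ
  M = k + (length w + 2)

  k≤M : k ≤ M
  k≤M = ℕ.m≤m+n k (length w + 2)

  open Marker a≢b w M (ℕ.m≤n+m (length w + 2) k)

  -- `y` contains `w`, which is not a factor of X*.
  y∤star-X : ∀ {v} → v ∈ Star X → ¬ Factor y v
  y∤star-X {v} v∈ y≤v with p , q , eq ← factor⇒ y≤v = w∉ (v , v∈ , subst (Factor w) eq′ (factor⇐ (p ++ replicate M a ++ [ b ])))
    where
    eq′ : (p ++ replicate M a ++ [ b ]) ++ w ++ (a ∷ replicate M b) ++ q ≡ v
    eq′ = begin
      (p ++ replicate M a ++ [ b ]) ++ w ++ (a ∷ replicate M b) ++ q
        ≡⟨ ++-assoc p _ _ ⟩
      p ++ (replicate M a ++ [ b ]) ++ w ++ (a ∷ replicate M b) ++ q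
        ≡⟨ cong (p ++_) (++-assoc (replicate M a) [ b ] _) ⟩
      p ++ replicate M a ++ b ∷ w ++ (a ∷ replicate M b) ++ q
        ≡⟨ cong (p ++_) (y++ q) ⟨
      p ++ y ++ q
        ≡⟨ eq ⟩
      v ∎
      where open ≡-Reasoning

  open Completion X code-X (regular? (regular-Star _≟_ regular-X)) _≟_ y y≢[] unbordered y∤star-X public

  added-prefix : ∀ {z} → z ∈ Added → ∃[ r ] z ≡ y ++ r
  added-prefix (_ , r , refl , _ , refl) = r , refl

  added-suffix : ∀ {z} → z ∈ Added → ∃[ r ] z ≡ r ++ y
  added-suffix (_ , _ , refl , (ws , ws∈ , refl) , refl) = go ws∈
    where
    go : ∀ {ws} → All (Filler ∙ ｛ y ｝) ws → ∃[ r ] y ++ concat ws ≡ r ++ y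
    go [] = [] , ++-identityʳ y
    go {_ ∷ ws} ((u , _ , _ , refl , refl) ∷ ws∈) with r , eq ← go ws∈ = y ++ u ++ r , (begin
      y ++ (u ++ y) ++ concat ws  ≡⟨ cong (y ++_) (++-assoc u y (concat ws)) ⟩
      y ++ u ++ y ++ concat ws    ≡⟨ cong (λ v → y ++ u ++ v) eq ⟩
      y ++ u ++ r ++ y            ≡⟨ cong (y ++_) (++-assoc u r y) ⟨
      y ++ (u ++ r) ++ y          ≡⟨ ++-assoc y (u ++ r) y ⟨
      (y ++ u ++ r) ++ y          ∎)
      where open ≡-Reasoning

  private
    starts : ∀ {z} → z ∈ Added → ∃[ u ] z ≡ replicate M a ++ b ∷ w ++ a ∷ replicate M b ++ u
    starts z∈ with r , refl ← added-prefix z∈ =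
      r , y++ r

    ends : ∀ {z} → z ∈ Added → ∃[ u ] z ≡ u ++ a ∷ replicate M b
    ends z∈ with r , refl ← added-suffix z∈ =
      r ++ replicate M a ++ b ∷ w , (begin
        r ++ replicate M a ++ b ∷ w ++ a ∷ replicate M b       ≡⟨ cong (r ++_) (++-assoc (replicate M a) (b ∷ w) _) ⟨
        r ++ (replicate M a ++ b ∷ w) ++ a ∷ replicate M b     ≡⟨ ++-assoc r (replicate M a ++ b ∷ w) _ ⟨
        (r ++ replicate M a ++ b ∷ w) ++ a ∷ replicate M b     ∎)
      where open ≡-Reasoning

    -- An added word begins with `y` and so has more than 2M letters, of which at most `k`, hence at
    -- most `M`, lie outside `f`.
    M<factor : ∀ s f t {z} → z ∈ Added → s ++ f ++ t ≡ z → length s + length t ≤ k → M < length f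
    M<factor s f t z∈ eq st≤k with r , refl ← added-prefix z∈ =
      ℕ.+-cancelˡ-< M _ _ (begin-strict
        M + M                            <⟨ 2M<∣y∣ ⟩
        length y                         ≤⟨ ℕ.m≤m+n (length y) (length r) ⟩
        length y + length r              ≡⟨ length-++ y ⟨
        length (y ++ r)                  ≡⟨ cong length eq ⟨
        length (s ++ f ++ t)             ≡⟨ trans (length-++ s) (cong (length s +_) (length-++ f)) ⟩
        length s + (length f + length t) ≡⟨ swap (length s) (length f) (length t) ⟩
        (length s + length t) + length f ≤⟨ ℕ.+-monoˡ-≤ (length f) (ℕ.≤-trans st≤k k≤M) ⟩
        M + length f                     ∎)
      where
      open ℕ.≤-Reasoning
      swap : ∀ s f t → s + (f + t) ≡ (s + t) + f
      swap = solve-∀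

    left≤ : ∀ (s t : List A) → length s + length t ≤ k → length s ≤ M
    left≤ s t st≤k = ℕ.≤-trans (ℕ.m+n≤o⇒m≤o (length s) st≤k) k≤M

    right≤ : ∀ (s t : List A) → length s + length t ≤ k → length t ≤ M
    right≤ s t st≤k = ℕ.≤-trans (ℕ.m+n≤o⇒n≤o (length s) st≤k) k≤M

    M≤ : ∀ (u : List A) x → M ≤ length (replicate M x ++ u)
    M≤ u x = ℕ.≤-trans (ℕ.≤-reflexive (sym (length-replicate M))) (length-++-≤ˡ (replicate M x))

    -- The opening runs give `s ≡ s′` and the closing runs `t ≡ t′`, after which both words are
    -- `s ++ f ++ t`.
    added-separated : ∀ {z z′} → z ∈ Added → z′ ∈ Added → Close k z z′ → z ≡ z′
    added-separated z∈ z∈′ (close s f t s′ t′ refl refl st≤k st≤k′)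
      with M<f ← M<factor s f t z∈ refl st≤k
      with refl ← same-offset a≢b M f s s′ (proj₂ (starts z∈)) (proj₂ (starts z∈′))
             (left≤ s t st≤k) (left≤ s′ t′ st≤k′) M<f
      with refl ← same-offsetʳ a≢b M f s s t t′ (proj₂ (ends z∈)) (proj₂ (ends z∈′))
             (right≤ s t st≤k) (right≤ s t′ st≤k′) M<f
      = refl

    -- The letters of `z` outside `f` are too few to reach the first `w` in it from either side, so
    -- `f` contains `w`, and with it the word `x` of X.
    mixed-separated : ∀ {x z} → x ∈ X → z ∈ Added → ∀ s f t u v →
      u ++ f ++ v ≡ x → s ++ f ++ t ≡ z → length s + length t ≤ k → ⊥
    mixed-separated {x} x∈ z∈ s f t u v refl refl st≤k with r , eq ← starts z∈ =
      w∉ (x , (x ∷ [] , x∈ ∷ [] , ++-identityʳ x) , u ++ⁱ (w≤f ⁱ++ v))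
      where
      w≤f : Factor w f
      w≤f = factor-within s f t (replicate M a ++ [ b ]) w (a ∷ replicate M b ++ r)
        (trans eq (sym (++-assoc (replicate M a) [ b ] _)))
        (ℕ.≤-trans (left≤ s t st≤k) (M≤ [ b ] a))
        -- The run of b's after `w` already has `M` letters, so `r` may be empty.
        (ℕ.≤-trans (right≤ s t st≤k) (ℕ.≤-trans (M≤ r b) (ℕ.n≤1+n _)))

  regular-Z : Regular Z
  regular-Z = regular-∪ regular-X (regular-∙ regular-y (regular-Star _≟_ (regular-∙
    (regular-∁ (regular-∪ (regular-Star _≟_ regular-X) (regular-Factor _≟_ y))) regular-y)))
    where regular-y = regular-｛ _≟_ ｝ y

  independent : Independent (antireflexive (𝓕 k)) Z
  independent z′ ((z , inj₁ z∈ , zz′) , inj₁ z∈′) = independent-X z′ ((z , z∈ , zz′) , z∈′)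
  independent z′ ((z , inj₂ z∈ , 𝓕zz′ , z≢z′) , inj₂ z∈′) = z≢z′ (added-separated z∈ z∈′ (𝓕⇒Close 𝓕zz′))
  -- The two mixed cases differ only in which half of `Close` belongs to the added word.
  independent z′ ((z , inj₁ z∈ , 𝓕zz′ , _) , inj₂ z∈′)
    with close s f t s′ t′ w≡ w′≡ _ ≤k′ ← 𝓕⇒Close 𝓕zz′ = mixed-separated z∈ z∈′ s′ f t′ s t w≡ w′≡ ≤k′
  independent z′ ((z , inj₂ z∈ , 𝓕zz′ , _) , inj₁ z∈′)
    with close s f t s′ t′ w≡ w′≡ ≤k _ ← 𝓕⇒Close 𝓕zz′ = mixed-separated z∈′ z∈ s f t s′ t′ w′≡ w≡ ≤k

  embedding : ∃[ Z ] Complete Z × Regular Z × Code Z × Independent (antireflexive (𝓕 k)) Z × X ⊆ Z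
  embedding = Z , complete , regular-Z , code , independent , inj₁

proposition5p3 : ∀ {A : Set} {m : ℕ} → A ↔ Fin m → 2 ≤ m →
    ∀ (k : ℕ) → 1 ≤ k →
    ∀ (X : Language A) →
    Regular X → Code X → Independent (antireflexive (𝓕 k)) X →
    ∃[ Z ] Complete Z × Regular Z × Code Z × Independent (antireflexive (𝓕 k)) Z × X ⊆ Z
proposition5p3 A↔Fin 2≤m k _ X regular-X code-X independent-X
  with regular-F ← regular-Factors A↔Fin (regular-Star (≟-finite A↔Fin) regular-X)
  with nonempty? A↔Fin (regular-∁ regular-F)
-- No word is missing from the factors of X*, so X itself is complete; membership in a regular
-- language is decidable, which removes the double negation.
... | no all-factors =
  X , (λ w → decidable-stable (regular? regular-F w) (λ w∉ → all-factors (w , w∉))) ,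
  regular-X , code-X , independent-X , λ x∈ → x∈
... | yes (w , w∉) =
  let _ , _ , a≢b = two-letters A↔Fin 2≤m
  in Embedding.embedding (≟-finite A↔Fin) a≢b k regular-X code-X independent-X w w∉
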